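{- Each of the parameterized problems \textsc{Hamiltonian Cycle}[vc] and \textsc{Hamiltonian Path}[vc] admits a polynomial boundaried kernelization whose output graph has $\mathcal{O}(|B|+k)$ vertices, where $B$ is the boundary of the input boundaried graph $G_B$ and $k$ is the size of the given vertex cover of $G$.
   Context: A boundaried graph $G_B$ is a finite simple graph $G$ together with a set $B\subseteq V(G)$ (the boundary). For boundaried graphs $G_B$ and $H_C$ with $V(G)\cap V(H)\subseteq B\cap C$, the gluing $G_B\oplus H_C$ is the simple graph obtained from the disjoint union of $G$ and $H$ by identifying each vertex of $B\cap C$ in $G$ with the identically named vertex in $H$ (an edge present in both is kept once). A pure graph problem is either a decision problem given by an isomorphism-closed class $\Pi$ of graphs, or an isomorphism-invariant optimization problem on graphs. For a decision problem $\Pi$, two $B$-boundaried graphs $G_B,G'_B$ are gluing equivalent w.r.t. $\Pi$ and $B$, written $G_B\equiv_{\Pi,B}G'_B$, if for every boundaried graph $H_B$ we have $G_B\oplus H_B\in\Pi\iff G'_B\oplus H_B\in\Pi$. For a pure graph minimization problem $\rho$, a $\rho$-solution of $G$ is a feasible solution $s$ of $\rho$ on $G$, with value $\rho(G,s)$. For computable $f$, a boundaried kernelization of size $f$ for a decision problem $\Pi[\rho]$ is a polynomial-time algorithm that, given a boundaried graph $G_B$ and a $\rho$-solution $s$ of $G$, outputs a boundaried graph $G'_B$ with $G_B\equiv_{\Pi,B}G'_B$ and a $\rho$-solution $s'$ of $G'$ such that $|G'|,|s'|,\rho(G',s')\le f(|B|+\rho(G,s))$ (here $|\cdot|$ is encoding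 size). It is polynomial if $f$ is bounded by a polynomial. \textsc{Hamiltonian Cycle} (resp. \textsc{Hamiltonian Path}) is the decision problem of whether $G$ has a cycle (resp. path) visiting every vertex exactly once. \textsc{Vertex Cover} (vc) is the minimization problem with feasible solutions $S\subseteq V(G)$ such that $G-S$ is edgeless, value $|S|$; $\Pi$[vc] means $\rho=$ \textsc{Vertex Cover}. -}

module Defs where

open import Data.Bool using (Bool; if_then_else_)
open import Data.Fin using (Fin; toℕ; _≟_)
open import Data.Fin.Properties using (any?)
open import Data.Fin.Subset using (Subset; _∉_; ∣_∣)
open import Data.List using (List; []; _∷_; _++_; _∷ʳ_; [_]; length; map; concatMap; replicate; allFin)
open import Data.List.Membership.Propositional using (_∈_)
open import Data.List.Membership.Propositional.Properties using (∈-map⁺)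
open import Data.List.Properties using (length-map; map-++)
open import Data.List.Relation.Unary.Linked as Linked using (Linked)
import Data.List.Relation.Unary.Linked.Properties as Linkedₚ
open import Data.List.Relation.Unary.Unique.Propositional using (Unique)
import Data.List.Relation.Unary.Unique.Propositional.Properties as Uniqueₚ
open import Data.Maybe as Maybe using (Maybe; just; nothing)
open import Data.Nat using (ℕ; suc; _+_; _*_; _≤_)
open import Data.Product using (Σ; ∃-syntax; _×_; _,_)
open import Data.Sum as Sum using (_⊎_; inj₁; inj₂)
open import Data.Sum.Properties using (inj₁-injective; inj₂-injective)
open import Data.Vec as Vec using (Vec)
open import Function using (_∘_)
open import Function.Bundles using (_⇔_; _↔_; Inverse)
open import Function.Definitions using (Injective)
open import Relation.Binary using (Decidable)
open import Relation.Binary.PropositionalEquality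
  using (_≡_; _≢_; refl; sym; trans; cong; subst)
open import Relation.Nullary using (¬_; Dec; yes; no; does)

------------------------------------------------------------------------
-- Graphs and pure graph decision problems

record Graph (V : Set) : Set₁ where
  field
    E       : V → V → Set
    E-sym   : ∀ {u v} → E u v → E v u
    E-irrefl : ∀ {v} → ¬ E v v

open Graph public

record _≅_ {V W : Set} (G : Graph V) (H : Graph W) : Set where
  field
    bijection  : V ↔ W
  open Inverse bijection public
  field
    preserves : ∀ {u v} → E G u v → E H (to u) (to v)
    reflects  : ∀ {u v} → E H (to u) (to v) → E G u v

record DecisionProblem : Set₁ where
  field
    Holds      : ∀ {V} → Graph V → Set
    iso-closed : ∀ {V W} {G : Graph V} {H : Graph W} → G ≅ H → Holds G → Holds H

open DecisionProblem public

-- A Hamiltonian cycle x₀ x₁ … xₗ: consecutive vertices of x₀ x₁ … xₗ x₀ are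
-- adjacent, and there are at least three of them.
IsHamiltonianCycle : ∀ {V} → Graph V → V → List V → Set
IsHamiltonianCycle G x xs =
    3 ≤ length (x ∷ xs)
  × Unique (x ∷ xs)
  × Linked (E G) ((x ∷ xs) ∷ʳ x)
  × (∀ v → v ∈ x ∷ xs)

-- Paths have at least one vertex, so the empty graph has no Hamiltonian path.
IsHamiltonianPath : ∀ {V} → Graph V → V → List V → Set
IsHamiltonianPath G x xs =
    Unique (x ∷ xs)
  × Linked (E G) (x ∷ xs)
  × (∀ v → v ∈ x ∷ xs)

module _ {V W : Set} {G : Graph V} {H : Graph W} (φ : G ≅ H) where
  open _≅_ φ

  private
    unique⁺ : ∀ {xs} → Unique xs → Unique (map to xs)
    unique⁺ = Uniqueₚ.map⁺ λ {x} {y} eq →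
      trans (sym (strictlyInverseʳ x)) (trans (cong from eq) (strictlyInverseʳ y))

    linked⁺ : ∀ {xs} → Linked (E G) xs → Linked (E H) (map to xs)
    linked⁺ = Linkedₚ.map⁺ ∘ Linked.map preserves

    covers⁺ : ∀ {xs} → (∀ v → v ∈ xs) → ∀ w → w ∈ map to xs
    covers⁺ {xs} cov w =
      subst (_∈ map to xs) (strictlyInverseˡ w) (∈-map⁺ to (cov (from w)))

  cycle-iso : ∀ {x xs} → IsHamiltonianCycle G x xs → IsHamiltonianCycle H (to x) (map to xs)
  cycle-iso {x} {xs} (len , uniq , link , cov) =
      subst (3 ≤_) (sym (length-map to (x ∷ xs))) len
    , unique⁺ uniq
    , subst (Linked (E H)) (map-++ to (x ∷ xs) [ x ]) (linked⁺ link)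
    , covers⁺ cov

  path-iso : ∀ {x xs} → IsHamiltonianPath G x xs → IsHamiltonianPath H (to x) (map to xs)
  path-iso (uniq , link , cov) = unique⁺ uniq , linked⁺ link , covers⁺ cov

HamiltonianCycle : DecisionProblem
HamiltonianCycle = record
  { Holds      = λ G → ∃[ x ] ∃[ xs ] IsHamiltonianCycle G x xs
  ; iso-closed = λ φ (x , xs , c) → _ , _ , cycle-iso φ c
  }

HamiltonianPath : DecisionProblem
HamiltonianPath = record
  { Holds      = λ G → ∃[ x ] ∃[ xs ] IsHamiltonianPath G x xs
  ; iso-closed = λ φ (x , xs , p) → _ , _ , path-iso φ p
  }

------------------------------------------------------------------------
-- Boundaried graphs and gluing

-- The boundary B is the set Fin b of names; `boundary` says which vertex
-- carries which name.  The other vertices need no name that is meaningful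
-- outside of the graph, as gluing never identifies them.
record BoundariedGraph (b : ℕ) : Set₁ where
  field
    order              : ℕ
    graph              : Graph (Fin order)
    E?                 : Decidable (E graph)
    boundary           : Fin b → Fin order
    boundary-injective : Injective _≡_ _≡_ boundary

  OnBoundary : Fin order → Set
  OnBoundary v = ∃[ i ] boundary i ≡ v

  onBoundary? : ∀ v → Dec (OnBoundary v)
  onBoundary? v = any? λ i → boundary i ≟ v

  record Interior : Set where
    constructor interior
    field
      vertex      : Fin order
      .nonBoundary : ¬ OnBoundary vertex

  locate : Fin order → Fin b ⊎ Interior
  locate v with onBoundary? v
  ... | yes (i , _) = inj₁ i
  ... | no ¬p       = inj₂ (interior v ¬p)

  locate-injective : ∀ u v → locate u ≡ locate v → u ≡ v
  locate-injective u v eq with onBoundary? u | onBoundary? v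
  locate-injective u v refl | yes (i , p) | yes (.i , q) = trans (sym p) q
  locate-injective u v refl | no _        | no _         = refl

open BoundariedGraph public using (order; graph; E?; boundary; Interior)

module _ {b : ℕ} (G H : BoundariedGraph b) where
  private
    module G = BoundariedGraph G
    module H = BoundariedGraph H

  -- Boundary vertices with the same name are identified; interiors stay disjoint.
  GluedVertex : Set
  GluedVertex = Fin b ⊎ (Interior G ⊎ Interior H)

  inˡ : Fin (order G) → GluedVertex
  inˡ v = Sum.map₂ inj₁ (G.locate v)

  inʳ : Fin (order H) → GluedVertex
  inʳ v = Sum.map₂ inj₂ (H.locate v)

  data GluedEdge : GluedVertex → GluedVertex → Set where
    fromˡ : ∀ {u v} → E (graph G) u v → GluedEdge (inˡ u) (inˡ v)
    fromʳ : ∀ {u v} → E (graph H) u v → GluedEdge (inʳ u) (inʳ v)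

  private
    map₂-injective : ∀ {A B C : Set} {f : B → C} → (∀ {x y} → f x ≡ f y → x ≡ y) →
      (x y : A ⊎ B) → Sum.map₂ f x ≡ Sum.map₂ f y → x ≡ y
    map₂-injective inj (inj₁ x) (inj₁ y) eq = cong inj₁ (inj₁-injective eq)
    map₂-injective inj (inj₂ x) (inj₂ y) eq = cong inj₂ (inj (inj₂-injective eq))

    inˡ-injective : ∀ u v → inˡ u ≡ inˡ v → u ≡ v
    inˡ-injective u v eq =
      G.locate-injective u v (map₂-injective inj₁-injective (G.locate u) (G.locate v) eq)

    inʳ-injective : ∀ u v → inʳ u ≡ inʳ v → u ≡ v
    inʳ-injective u v eq =
      H.locate-injective u v (map₂-injective inj₂-injective (H.locate u) (H.locate v) eq)

    glued-distinct : ∀ {x y} → GluedEdge x y → x ≢ y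
    glued-distinct (fromˡ {u} {v} e) eq with inˡ-injective u v eq
    ... | refl = E-irrefl (graph G) e
    glued-distinct (fromʳ {u} {v} e) eq with inʳ-injective u v eq
    ... | refl = E-irrefl (graph H) e

  infixl 6 _⊕_

  _⊕_ : Graph GluedVertex
  _⊕_ = record
    { E        = GluedEdge
    ; E-sym    = λ where
        (fromˡ e) → fromˡ (E-sym (graph G) e)
        (fromʳ e) → fromʳ (E-sym (graph H) e)
    ; E-irrefl = λ e → glued-distinct e refl
    }

GluingEquivalent : DecisionProblem → ∀ {b} → BoundariedGraph b → BoundariedGraph b → Set₁
GluingEquivalent Π G G′ = ∀ H → Holds Π (G ⊕ H) ⇔ Holds Π (G′ ⊕ H)

------------------------------------------------------------------------
-- Vertex Cover

IsVertexCover : ∀ {n} → Graph (Fin n) → Subset n → Set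
IsVertexCover G S = ∀ u v → u ∉ S → v ∉ S → ¬ E G u v

------------------------------------------------------------------------
-- Growth of functions

-- Coefficients, constant term first.
Polynomial : Set
Polynomial = List ℕ

⟦_⟧ : Polynomial → ℕ → ℕ
⟦ []    ⟧ x = 0
⟦ a ∷ p ⟧ x = a + x * ⟦ p ⟧ x

_∈O_ : (ℕ → ℕ) → (ℕ → ℕ) → Set
f ∈O g = ∃[ c ] ∃[ n₀ ] (∀ n → n₀ ≤ n → f n ≤ c * g n)

------------------------------------------------------------------------
-- Deterministic multi-tape Turing machines

data Symbol : Set where
  𝟎 𝟏 ♯ : Symbol

-- `nothing` is the blank.
Cell : Set
Cell = Maybe Symbol

data Move : Set where
  left stay right : Move

-- A two-way infinite tape.  The cells to the left of the head are listed
-- nearest first; all cells not listed are blank.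
record Tape : Set where
  constructor tape
  field
    before : List Cell
    head   : Cell
    after  : List Cell

open Tape public

act : Cell × Move → Tape → Tape
act (c , stay)  (tape ls      _ rs)       = tape ls c rs
act (c , left)  (tape []      _ rs)       = tape [] nothing (c ∷ rs)
act (c , left)  (tape (l ∷ ls) _ rs)      = tape ls l (c ∷ rs)
act (c , right) (tape ls      _ [])       = tape (c ∷ ls) nothing []
act (c , right) (tape ls      _ (r ∷ rs)) = tape (c ∷ ls) r rs

blankTape : Tape
blankTape = tape [] nothing []

inputTape : List Symbol → Tape
inputTape []       = blankTape
inputTape (x ∷ xs) = tape [] (just x) (map just xs)

blankFreePrefix : List Cell → List Symbol
blankFreePrefix []             = []
blankFreePrefix (nothing ∷ _)  = []
blankFreePrefix (just x ∷ xs)  = x ∷ blankFreePrefix xs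

-- The output is the word that starts at the head and extends to the first blank.
outputWord : Tape → List Symbol
outputWord t = blankFreePrefix (head t ∷ after t)

record TuringMachine : Set₁ where
  field
    State    : Set
    states   : List State
    finite   : ∀ q → q ∈ states
    start    : State
    workTapes : ℕ
    -- `nothing` means that the machine halts.
    δ        : State → Vec Cell (suc workTapes) →
               Maybe (State × Vec (Cell × Move) (suc workTapes))

  Config : Set
  Config = State × Vec Tape (suc workTapes)

  initial : List Symbol → Config
  initial w = start , inputTape w Vec.∷ Vec.replicate workTapes blankTape

  output : Config → List Symbol
  output (_ , ts) = outputWord (Vec.head ts)

  step : Config → Maybe Config
  step (q , ts) = Maybe.map (λ (q′ , as) → q′ , Vec.zipWith act as ts) (δ q (Vec.map head ts))

  data HaltsAfter : Config → ℕ → Config → Set where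
    halted : ∀ {c} → step c ≡ nothing → HaltsAfter c 0 c
    next   : ∀ {c c′ d t} → step c ≡ just c′ → HaltsAfter c′ t d → HaltsAfter c (suc t) d

  ComputesWithin : ℕ → List Symbol → List Symbol → Set
  ComputesWithin bound w u =
    ∃[ t ] ∃[ d ] t ≤ bound × HaltsAfter (initial w) t d × output d ≡ u

------------------------------------------------------------------------
-- Encodings

bit : Bool → Symbol
bit x = if x then 𝟏 else 𝟎

-- The rows of the adjacency matrix, each followed by ♯; a ♯; for each name
-- i < b the index of its vertex in unary, each followed by 𝟎; a ♯.
encodeGraph : ∀ {b} → BoundariedGraph b → List Symbol
encodeGraph {b} G =
     concatMap (λ u → map (λ v → bit (does (E? G u v))) (allFin (order G)) ++ [ ♯ ]) (allFin (order G))
  ++ [ ♯ ]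
  ++ concatMap (λ i → replicate (toℕ (boundary G i)) 𝟏 ++ [ 𝟎 ]) (allFin b)
  ++ [ ♯ ]

encodeSubset : ∀ {n} → Subset n → List Symbol
encodeSubset S = map bit (Vec.toList S)

encodeInstance : ∀ {b} (G : BoundariedGraph b) → Subset (order G) → List Symbol
encodeInstance G S = encodeGraph G ++ encodeSubset S

------------------------------------------------------------------------
-- Boundaried kernelizations for Π[vc]

record BoundariedKernelization[vc] (Π : DecisionProblem) (f : ℕ → ℕ) : Set₁ where
  field
    machine : TuringMachine
    time    : Polynomial

    kernel  : ∀ {b} (G : BoundariedGraph b) (S : Subset (order G)) →
              IsVertexCover (graph G) S → BoundariedGraph b
    cover   : ∀ {b} (G : BoundariedGraph b) S (vc : IsVertexCover (graph G) S) →
              Subset (order (kernel G S vc))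

    computes : ∀ {b} (G : BoundariedGraph b) S (vc : IsVertexCover (graph G) S) →
      TuringMachine.ComputesWithin machine
        (⟦ time ⟧ (length (encodeInstance G S)))
        (encodeInstance G S)
        (encodeInstance (kernel G S vc) (cover G S vc))

    equivalent : ∀ {b} (G : BoundariedGraph b) S (vc : IsVertexCover (graph G) S) →
      GluingEquivalent Π G (kernel G S vc)

    is-cover : ∀ {b} (G : BoundariedGraph b) S (vc : IsVertexCover (graph G) S) →
      IsVertexCover (graph (kernel G S vc)) (cover G S vc)

    graph-size : ∀ {b} (G : BoundariedGraph b) S (vc : IsVertexCover (graph G) S) →
      length (encodeGraph (kernel G S vc)) ≤ f (b + ∣ S ∣)
    cover-size : ∀ {b} (G : BoundariedGraph b) S (vc : IsVertexCover (graph G) S) →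
      length (encodeSubset (cover G S vc)) ≤ f (b + ∣ S ∣)
    cover-value : ∀ {b} (G : BoundariedGraph b) S (vc : IsVertexCover (graph G) S) →
      ∣ cover G S vc ∣ ≤ f (b + ∣ S ∣)

open BoundariedKernelization[vc] public

OutputOrderAtMost : ∀ {Π f} → BoundariedKernelization[vc] Π f → (ℕ → ℕ) → Set₁
OutputOrderAtMost K g = ∀ {b} (G : BoundariedGraph b) S (vc : IsVertexCover (graph G) S) →
  order (kernel K G S vc) ≤ g (b + ∣ S ∣)

-- The size bound f is taken to be a polynomial itself, hence computable: a size
-- bound may always be replaced by a polynomial above it.
PolynomialKernelizationOfLinearOrder : DecisionProblem → Set₁
PolynomialKernelizationOfLinearOrder Π =
  ∃[ p ] Σ (BoundariedKernelization[vc] Π ⟦ p ⟧) λ K →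
    ∃[ g ] g ∈O (λ x → x) × OutputOrderAtMost K g

{-# OPTIONS --safe #-}
module Submission where

-- In G ⊕ H the neighbours of an interior vertex of G outside the vertex cover S
-- lie in S.  On a Hamiltonian path all such vertices but the last have distinct
-- successors in S, so at most |S| + b + 1 vertices of G are outside S.  If there
-- are more than |S| + b + 2, then no gluing of G has a Hamiltonian path, let
-- alone a Hamiltonian cycle, and G may be replaced by the edgeless graph of order
-- |S| + b + 2, which has at least two interior vertices.  Otherwise G has at most
-- 2|S| + b + 2 vertices and is its own kernel.  A Turing machine decides between
-- the two cases with unary counters.

open import Defs
open import Data.Bool using (Bool; true; false)
open import Data.Empty using (⊥; ⊥-elim; ⊥-elim-irr)
open import Data.Fin using (Fin; zero; suc; toℕ; inject≤; opposite)
open import Data.Fin.Properties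
  using (toℕ<n; toℕ-inject≤; toℕ-inject₁; toℕ-fromℕ; opposite-involutive; inject≤-injective; suc-injective)
open import Data.Fin.Subset as Subset using (Subset; inside; outside; ∁; ∣_∣)
open import Data.Fin.Subset.Properties using (_∈?_; x∈∁p⇒x∉p; ∣⊥∣≡0; ∣∁p∣≡n∸∣p∣; ∣p∣≤n)
open import Data.List
  using (List; []; _∷_; _++_; _ʳ++_; [_]; length; map; concat; concatMap; replicate; filter; allFin; tabulate)
open import Data.List.Membership.Propositional using (_∈_)
open import Data.List.Membership.Propositional.Properties
  using (∈-∃++; ∈-++⁻; ∈-++⁺ˡ; ∈-++⁺ʳ; ∈-map⁺; ∈-map⁻; ∈-allFin; ∈-filter⁺; ∈-filter⁻)
open import Data.List.Properties
open import Data.List.Relation.Binary.Subset.Propositional using (_⊆_)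
open import Data.List.Relation.Unary.All as All using ()
open import Data.List.Relation.Unary.AllPairs as AllPairs using ([]; _∷_)
open import Data.List.Relation.Unary.Any using (here; there)
open import Data.List.Relation.Unary.Linked using (Linked; []; [-]; _∷_)
open import Data.List.Relation.Unary.Unique.Propositional using (Unique)
open import Data.List.Relation.Unary.Unique.Propositional.Properties as Uniqueₚ
  using (Unique[x∷xs]⇒x∉xs)
open import Data.Maybe using (Maybe; just; nothing)
open import Data.Nat using (ℕ; zero; suc; _+_; _*_; _∸_; _≤_; _<_; z≤n; s≤s; _≤?_)
open import Data.Nat.Properties hiding (suc-injective)
open import Data.Nat.Tactic.RingSolver using (solve-∀)
open import Data.Product using (∃-syntax; _×_; _,_; proj₂)
open import Data.Sum using (_⊎_; inj₁; inj₂)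
open import Data.Vec as Vec using (Vec; []; _∷_; here; there)
open import Data.Vec.Properties using (toList-replicate; length-toList)
open import Function using (_∘_; id)
open import Function.Bundles using (mk⇔)
open import Level using (0ℓ)
open import Relation.Binary using (Rel)
open import Relation.Binary.PropositionalEquality
  using (_≡_; refl; sym; trans; cong; cong₂; subst; subst₂)
open import Relation.Nullary using (¬_; Dec; yes; no; does)
open import Relation.Nullary.Decidable using (¬?)
open import Relation.Unary as Unary using (Pred)

-- The path bound alone would permit the threshold |S| + b + 1. The extra unit lets one lemma refute
-- both graphs: an edgeless graph of order m has the empty cover, for which the bound reads m ≤ b +
-- 1, and m = |S| + b + 2 violates this even if S is empty. With one vertex fewer and S empty, the
-- replacement could be a single vertex for b = 0, which has a Hamiltonian path. The order of the
-- replacement equals the threshold because that number is already on a tape when the machine has to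
-- write. Both problems share kernel, cover and machine: the argument uses only that a solution
-- yields a Hamiltonian path of the glued graph. The bulk of the work lies in the machine model. The
-- encoding states neither b nor |S| as a number, so both are recovered by counting symbols, and the
-- replacement must be written symbol by symbol in the format of the encoding.

-- Hamiltonian paths and the vertices outside a cover

-- Pigeonhole by deletion: one occurrence of the head of `xs` is cut out of `ys`, and the tail still
-- embeds because uniqueness keeps that head out of it.
unique-⊆⇒length≤ : ∀ {A : Set} {xs ys : List A} → Unique xs → xs ⊆ ys → length xs ≤ length ys
unique-⊆⇒length≤ {xs = []}     _ _ = z≤n
unique-⊆⇒length≤ {xs = x ∷ xs} u@(_ ∷ uniq) sub with ∈-∃++ (sub (here refl))
... | ys , zs , refl = begin
  suc (length xs)         ≤⟨ s≤s (unique-⊆⇒length≤ uniq sub′) ⟩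
  suc (length (ys ++ zs)) ≡⟨ length-++-sucʳ ys x zs ⟨
  length (ys ++ x ∷ zs)   ∎
  where
  open ≤-Reasoning
  sub′ : xs ⊆ ys ++ zs
  sub′ v∈xs with ∈-++⁻ ys (sub (there v∈xs))
  ... | inj₁ v∈ys         = ∈-++⁺ˡ v∈ys
  ... | inj₂ (here refl)  = ⊥-elim (Unique[x∷xs]⇒x∉xs u v∈xs)
  ... | inj₂ (there v∈zs) = ∈-++⁺ʳ ys v∈zs

linked-++⁻ˡ : ∀ {A : Set} {R : Rel A 0ℓ} xs {ys} → Linked R (xs ++ ys) → Linked R xs
linked-++⁻ˡ []           _       = []
linked-++⁻ˡ (x ∷ [])     _       = [-]
linked-++⁻ˡ (x ∷ y ∷ xs) (r ∷ l) = r ∷ linked-++⁻ˡ (y ∷ xs) l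

-- In a path the successors of the P-vertices are distinct Q-vertices; only the
-- last vertex has no successor.
linked-filter-≤ : ∀ {A : Set} {R : Rel A 0ℓ} {P Q : Pred A 0ℓ}
  (P? : Unary.Decidable P) (Q? : Unary.Decidable Q) → (∀ {x y} → R x y → P x → Q y) →
  ∀ {x xs} → Linked R (x ∷ xs) →
  length (filter P? (x ∷ xs)) ≤ suc (length (filter Q? xs))
linked-filter-≤ P? Q? P⇒Q {x} [-] = length-filter P? (x ∷ [])
linked-filter-≤ P? Q? P⇒Q {x} {y ∷ xs} (r ∷ l) with P? x
-- The successor `y` is a Q-vertex and pays for `x`; this is why the bound counts `xs` without its
-- predecessor `x`.
... | yes p rewrite filter-accept Q? {xs = xs} (P⇒Q r p) = s≤s (linked-filter-≤ P? Q? P⇒Q l)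
... | no ¬p = ≤-trans (linked-filter-≤ P? Q? P⇒Q l) (s≤s monotone)
  where
  monotone : length (filter Q? xs) ≤ length (filter Q? (y ∷ xs))
  monotone with Q? y
  ... | yes _ = n≤1+n _
  ... | no _  = ≤-refl

length-allFin : ∀ n → length (allFin n) ≡ n
length-allFin n = length-tabulate id

-- Subsets as duplicate-free lists

elements : ∀ {n} → Subset n → List (Fin n)
elements []            = []
elements (inside  ∷ p) = zero ∷ map suc (elements p)
elements (outside ∷ p) = map suc (elements p)

length-elements : ∀ {n} (p : Subset n) → length (elements p) ≡ ∣ p ∣
length-elements []            = refl
length-elements (inside  ∷ p) = cong suc (trans (length-map suc (elements p)) (length-elements p))
length-elements (outside ∷ p) = trans (length-map suc (elements p)) (length-elements p)

∈-elements⁺ : ∀ {n} {p : Subset n} {v} → v Subset.∈ p → v ∈ elements p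
∈-elements⁺                    here        = here refl
∈-elements⁺ {p = inside  ∷ _} (there v∈p) = there (∈-map⁺ suc (∈-elements⁺ v∈p))
∈-elements⁺ {p = outside ∷ _} (there v∈p) = ∈-map⁺ suc (∈-elements⁺ v∈p)

∈-elements⁻ : ∀ {n} (p : Subset n) {v} → v ∈ elements p → v Subset.∈ p
∈-elements⁻ (inside ∷ p) (here refl) = here
∈-elements⁻ (inside ∷ p) (there v∈) with ∈-map⁻ suc v∈
... | _ , w∈ , refl = there (∈-elements⁻ p w∈)
∈-elements⁻ (outside ∷ p) v∈ with ∈-map⁻ suc v∈
... | _ , w∈ , refl = there (∈-elements⁻ p w∈)

unique-elements : ∀ {n} (p : Subset n) → Unique (elements p)
unique-elements []            = []
unique-elements (inside  ∷ p) =
  All.tabulate (λ {v} v∈ zero≡v → zero≢suc (subst (_∈ _) (sym zero≡v) v∈))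
    ∷ Uniqueₚ.map⁺ suc-injective (unique-elements p)
  where
  zero≢suc : zero ∈ map suc (elements p) → ⊥
  zero≢suc z∈ with ∈-map⁻ suc z∈
  ... | _ , _ , ()
unique-elements (outside ∷ p) = Uniqueₚ.map⁺ suc-injective (unique-elements p)

-- The path bound in a glued graph

module _ {b} (G H : BoundariedGraph b) (S : Subset (order G)) where
  private
    module G = BoundariedGraph G
    module H = BoundariedGraph H

  -- Boundary vertices are left out even when they lie outside `S`, since they may have neighbours
  -- in `H` that no cover of `G` controls.
  Independent : Pred (GluedVertex G H) 0ℓ
  Independent (inj₁ i)        = ⊥
  Independent (inj₂ (inj₁ v)) = G.Interior.vertex v Subset.∉ S
  Independent (inj₂ (inj₂ _)) = ⊥

  Covering : Pred (GluedVertex G H) 0ℓ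
  Covering (inj₁ i)        = boundary G i Subset.∈ S
  Covering (inj₂ (inj₁ v)) = G.Interior.vertex v Subset.∈ S
  Covering (inj₂ (inj₂ _)) = ⊥

  independent? : Unary.Decidable Independent
  independent? (inj₁ i)        = no λ ()
  independent? (inj₂ (inj₁ v)) = ¬? (G.Interior.vertex v ∈? S)
  independent? (inj₂ (inj₂ _)) = no λ ()

  covering? : Unary.Decidable Covering
  covering? (inj₁ i)        = boundary G i ∈? S
  covering? (inj₂ (inj₁ v)) = G.Interior.vertex v ∈? S
  covering? (inj₂ (inj₂ _)) = no λ ()

  inˡ-injective : ∀ {u v} → inˡ G H u ≡ inˡ G H v → u ≡ v
  inˡ-injective {u} {v} eq with G.onBoundary? u | G.onBoundary? v
  inˡ-injective refl | yes (i , p) | yes (.i , q) = trans (sym p) q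
  inˡ-injective refl | no _        | no _         = refl

  independent-inˡ⁻ : ∀ u → Independent (inˡ G H u) → u Subset.∉ S
  independent-inˡ⁻ u with G.onBoundary? u
  ... | yes _ = λ ()
  ... | no _  = id

  ¬independent-inʳ : ∀ u → ¬ Independent (inʳ G H u)
  ¬independent-inʳ u with H.onBoundary? u
  ... | yes _ = id
  ... | no _  = id

  covering-inˡ⁺ : ∀ {v} → v Subset.∈ S → Covering (inˡ G H v)
  covering-inˡ⁺ {v} v∈S with G.onBoundary? v
  ... | yes (_ , refl) = v∈S
  ... | no _           = v∈S

  inˡ-∉ : ∀ {v} → v Subset.∉ S → (∃[ i ] inˡ G H v ≡ inj₁ i) ⊎ Independent (inˡ G H v)
  inˡ-∉ {v} v∉S with G.onBoundary? v
  ... | yes (i , _) = inj₁ (i , refl)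
  ... | no _        = inj₂ v∉S

  covering⇒inˡ : ∀ x → Covering x → ∃[ v ] v Subset.∈ S × inˡ G H v ≡ x
  covering⇒inˡ (inj₁ i) i∈S = boundary G i , i∈S , inˡ-boundary
    where
    inˡ-boundary : inˡ G H (boundary G i) ≡ inj₁ i
    inˡ-boundary with G.onBoundary? (boundary G i)
    ... | yes (j , eq) = cong inj₁ (G.boundary-injective eq)
    ... | no ¬p        = ⊥-elim (¬p (i , refl))
  covering⇒inˡ (inj₂ (inj₁ (G.interior v ¬p))) v∈S = v , v∈S , inˡ-interior
    where
    inˡ-interior : inˡ G H v ≡ inj₂ (inj₁ (G.interior v ¬p))
    inˡ-interior with G.onBoundary? v
    ... | yes p = ⊥-elim-irr (¬p p)
    ... | no _  = refl

  -- An interior vertex of `G` is no vertex of `H`, so each of its edges comes from `G`, where `S`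
  -- must cover it.
  independent-edge : IsVertexCover (graph G) S →
    ∀ {x y} → E (G ⊕ H) x y → Independent x → Covering y
  independent-edge vc (fromˡ {u} {v} e) x∈I with v ∈? S
  ... | yes v∈S = covering-inˡ⁺ v∈S
  ... | no v∉S  = ⊥-elim (vc u v (independent-inˡ⁻ u x∈I) v∉S e)
  independent-edge vc (fromʳ {u} e) x∈I = ⊥-elim (¬independent-inʳ u x∈I)

  -- Every vertex outside the cover is on the boundary or independent, and the
  -- path leaves all independent vertices but the last one through the cover.
  hamiltonianPath⇒∣∁S∣≤ : IsVertexCover (graph G) S → Holds HamiltonianPath (G ⊕ H) →
    ∣ ∁ S ∣ ≤ ∣ S ∣ + suc b
  hamiltonianPath⇒∣∁S∣≤ vc (x , xs , uniq , link , cov) = begin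
    ∣ ∁ S ∣                             ≡⟨ length-elements (∁ S) ⟨
    length (elements (∁ S))             ≡⟨ length-map (inˡ G H) (elements (∁ S)) ⟨
    length (map (inˡ G H) (elements (∁ S)))
      ≤⟨ unique-⊆⇒length≤ (Uniqueₚ.map⁺ inˡ-injective (unique-elements (∁ S))) outside⊆ ⟩
    length (map inj₁ (allFin b) ++ filter independent? (x ∷ xs))
      ≡⟨ length-++ (map inj₁ (allFin b)) ⟩
    length (map inj₁ (allFin b)) + length (filter independent? (x ∷ xs))
      ≡⟨ cong (_+ length (filter independent? (x ∷ xs))) (trans (length-map inj₁ (allFin b)) (length-allFin b)) ⟩
    b + length (filter independent? (x ∷ xs))
      ≤⟨ +-monoʳ-≤ b (linked-filter-≤ independent? covering? (independent-edge vc) link) ⟩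
    b + suc (length (filter covering? xs))
      ≤⟨ +-monoʳ-≤ b (s≤s (unique-⊆⇒length≤ (Uniqueₚ.filter⁺ covering? (AllPairs.tail uniq)) covering⊆)) ⟩
    b + suc (length (map (inˡ G H) (elements S)))
      ≡⟨ cong (λ k → b + suc k) (trans (length-map (inˡ G H) (elements S)) (length-elements S)) ⟩
    b + suc ∣ S ∣                       ≡⟨ +-suc b ∣ S ∣ ⟩
    suc b + ∣ S ∣                       ≡⟨ +-comm (suc b) ∣ S ∣ ⟩
    ∣ S ∣ + suc b                       ∎
    where
    open ≤-Reasoning
    outside⊆ : map (inˡ G H) (elements (∁ S)) ⊆ map inj₁ (allFin b) ++ filter independent? (x ∷ xs)
    outside⊆ y∈ with ∈-map⁻ (inˡ G H) y∈
    ... | v , v∈ , refl with inˡ-∉ (x∈∁p⇒x∉p (∈-elements⁻ (∁ S) v∈))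
    ...   | inj₁ (i , eq) = ∈-++⁺ˡ (subst (_∈ map inj₁ (allFin b)) (sym eq) (∈-map⁺ inj₁ (∈-allFin i)))
    ...   | inj₂ v∈I      = ∈-++⁺ʳ (map inj₁ (allFin b)) (∈-filter⁺ independent? (cov _) v∈I)
    covering⊆ : filter covering? xs ⊆ map (inˡ G H) (elements S)
    covering⊆ y∈ with covering⇒inˡ _ (proj₂ (∈-filter⁻ covering? {xs = xs} y∈))
    ... | v , v∈S , refl = ∈-map⁺ (inˡ G H) (∈-elements⁺ v∈S)

cycle⇒path : ∀ {V} {G : Graph V} → Holds HamiltonianCycle G → Holds HamiltonianPath G
cycle⇒path (x , xs , _ , uniq , link , cov) = x , xs , uniq , linked-++⁻ˡ (x ∷ xs) link , cov

-- The Turing machine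

data State : Set where
  start rowStart inRow inNames inCover compare : State
  writeRows writeRow returnRow writeNames writeName returnName writeCover : State
  rewind stop : State

pattern mark = just 𝟏

-- Tape 0 holds the input and the output.  While the input is read, tape 1
-- counts the names in unary, tape 2 counts |S| + b + 2, and tape 3 counts the
-- vertices outside of the cover.
δ : State → Vec Cell 4 → Maybe (State × Vec (Cell × Move) 4)
δ start      (x       ∷ p       ∷ q       ∷ r       ∷ []) = just (rowStart   , (x , stay)       ∷ (p , right)      ∷ (q , right)    ∷ (r , right)    ∷ [])
δ rowStart   (just ♯  ∷ p       ∷ q       ∷ r       ∷ []) = just (inNames    , (just ♯ , right) ∷ (p , stay)       ∷ (mark , right) ∷ (r , stay)     ∷ [])
δ rowStart   (x       ∷ p       ∷ q       ∷ r       ∷ []) = just (inRow      , (x , right)      ∷ (p , stay)       ∷ (q , stay)     ∷ (r , stay)     ∷ [])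
δ inRow      (just ♯  ∷ p       ∷ q       ∷ r       ∷ []) = just (rowStart   , (just ♯ , right) ∷ (p , stay)       ∷ (q , stay)     ∷ (r , stay)     ∷ [])
δ inRow      (x       ∷ p       ∷ q       ∷ r       ∷ []) = just (inRow      , (x , right)      ∷ (p , stay)       ∷ (q , stay)     ∷ (r , stay)     ∷ [])
δ inNames    (just ♯  ∷ p       ∷ q       ∷ r       ∷ []) = just (inCover    , (just ♯ , right) ∷ (p , stay)       ∷ (mark , right) ∷ (r , stay)     ∷ [])
δ inNames    (just 𝟎  ∷ p       ∷ q       ∷ r       ∷ []) = just (inNames    , (just 𝟎 , right) ∷ (mark , right)   ∷ (mark , right) ∷ (r , stay)     ∷ [])
δ inNames    (x       ∷ p       ∷ q       ∷ r       ∷ []) = just (inNames    , (x , right)      ∷ (p , stay)       ∷ (q , stay)     ∷ (r , stay)     ∷ [])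
δ inCover    (nothing ∷ p       ∷ q       ∷ r       ∷ []) = just (compare    , (nothing , stay) ∷ (p , stay)       ∷ (q , left)     ∷ (r , left)     ∷ [])
δ inCover    (just 𝟏  ∷ p       ∷ q       ∷ r       ∷ []) = just (inCover    , (just 𝟏 , right) ∷ (p , stay)       ∷ (mark , right) ∷ (r , stay)     ∷ [])
δ inCover    (x       ∷ p       ∷ q       ∷ r       ∷ []) = just (inCover    , (x , right)      ∷ (p , stay)       ∷ (q , stay)     ∷ (mark , right) ∷ [])
δ compare    (x       ∷ p       ∷ q       ∷ nothing ∷ []) = just (rewind     , (x , left)       ∷ (p , stay)       ∷ (q , stay)     ∷ (nothing , stay) ∷ [])
δ compare    (x       ∷ p       ∷ nothing ∷ r       ∷ []) = just (writeRows  , (x , right)      ∷ (p , stay)       ∷ (nothing , stay) ∷ (r , right)  ∷ [])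
δ compare    (x       ∷ p       ∷ q       ∷ r       ∷ []) = just (compare    , (x , stay)       ∷ (p , stay)       ∷ (q , left)     ∷ (r , left)     ∷ [])
δ writeRows  (x       ∷ p       ∷ q       ∷ nothing ∷ []) = just (writeNames , (just ♯ , right) ∷ (p , left)       ∷ (q , stay)     ∷ (nothing , stay) ∷ [])
δ writeRows  (x       ∷ p       ∷ q       ∷ r       ∷ []) = just (writeRow   , (x , stay)       ∷ (p , stay)       ∷ (q , right)    ∷ (r , stay)     ∷ [])
δ writeRow   (x       ∷ p       ∷ nothing ∷ r       ∷ []) = just (returnRow  , (just ♯ , right) ∷ (p , stay)       ∷ (nothing , left) ∷ (r , stay)   ∷ [])
δ writeRow   (x       ∷ p       ∷ q       ∷ r       ∷ []) = just (writeRow   , (just 𝟎 , right) ∷ (p , stay)       ∷ (q , right)    ∷ (r , stay)     ∷ [])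
δ returnRow  (x       ∷ p       ∷ nothing ∷ r       ∷ []) = just (writeRows  , (x , stay)       ∷ (p , stay)       ∷ (nothing , stay) ∷ (r , right)  ∷ [])
δ returnRow  (x       ∷ p       ∷ q       ∷ r       ∷ []) = just (returnRow  , (x , stay)       ∷ (p , stay)       ∷ (q , left)     ∷ (r , stay)     ∷ [])
δ writeNames (x       ∷ nothing ∷ q       ∷ r       ∷ []) = just (writeCover , (just ♯ , right) ∷ (nothing , stay) ∷ (q , right)    ∷ (r , stay)     ∷ [])
δ writeNames (x       ∷ p       ∷ q       ∷ r       ∷ []) = just (writeName  , (x , stay)       ∷ (nothing , left) ∷ (q , stay)     ∷ (r , stay)     ∷ [])
δ writeName  (x       ∷ nothing ∷ q       ∷ r       ∷ []) = just (returnName , (just 𝟎 , right) ∷ (nothing , right) ∷ (q , stay)    ∷ (r , stay)     ∷ [])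
δ writeName  (x       ∷ p       ∷ q       ∷ r       ∷ []) = just (writeName  , (just 𝟏 , right) ∷ (p , left)       ∷ (q , stay)     ∷ (r , stay)     ∷ [])
δ returnName (x       ∷ nothing ∷ q       ∷ r       ∷ []) = just (writeNames , (x , stay)       ∷ (nothing , left) ∷ (q , stay)     ∷ (r , stay)     ∷ [])
δ returnName (x       ∷ p       ∷ q       ∷ r       ∷ []) = just (returnName , (x , stay)       ∷ (p , right)      ∷ (q , stay)     ∷ (r , stay)     ∷ [])
δ writeCover (x       ∷ p       ∷ nothing ∷ r       ∷ []) = just (rewind     , (x , left)       ∷ (p , stay)       ∷ (nothing , stay) ∷ (r , stay)   ∷ [])
δ writeCover (x       ∷ p       ∷ q       ∷ r       ∷ []) = just (writeCover , (just 𝟎 , right) ∷ (p , stay)       ∷ (q , right)    ∷ (r , stay)     ∷ [])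
δ rewind     (nothing ∷ p       ∷ q       ∷ r       ∷ []) = just (stop       , (nothing , right) ∷ (p , stay)      ∷ (q , stay)     ∷ (r , stay)     ∷ [])
δ rewind     (x       ∷ p       ∷ q       ∷ r       ∷ []) = just (rewind     , (x , left)       ∷ (p , stay)       ∷ (q , stay)     ∷ (r , stay)     ∷ [])
δ stop       _                                            = nothing

kernelMachine : TuringMachine
kernelMachine = record
  { State     = State
  ; states    = states
  ; finite    = finite
  ; start     = start
  ; workTapes = 3
  ; δ         = δ
  }
  where
  states : List State
  states = start ∷ rowStart ∷ inRow ∷ inNames ∷ inCover ∷ compare ∷ writeRows ∷ writeRow ∷ returnRow
         ∷ writeNames ∷ writeName ∷ returnName ∷ writeCover ∷ rewind ∷ stop ∷ []
  finite : ∀ q → q ∈ states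
  finite start      = here refl
  finite rowStart   = there (here refl)
  finite inRow      = there (there (here refl))
  finite inNames    = there (there (there (here refl)))
  finite inCover    = there (there (there (there (here refl))))
  finite compare    = there (there (there (there (there (here refl)))))
  finite writeRows  = there (there (there (there (there (there (here refl))))))
  finite writeRow   = there (there (there (there (there (there (there (here refl)))))))
  finite returnRow  = there (there (there (there (there (there (there (there (here refl))))))))
  finite writeNames = there (there (there (there (there (there (there (there (there (here refl)))))))))
  finite writeName  = there (there (there (there (there (there (there (there (there (there (here refl))))))))))
  finite returnName = there (there (there (there (there (there (there (there (there (there (there (here refl)))))))))))
  finite writeCover = there (there (there (there (there (there (there (there (there (there (there (there (here refl))))))))))))
  finite rewind     = there (there (there (there (there (there (there (there (there (there (there (there (there (here refl)))))))))))))
  finite stop       = there (there (there (there (there (there (there (there (there (there (there (there (there (there (here refl))))))))))))))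

open TuringMachine kernelMachine using (Config; step; HaltsAfter; halted; next; initial; output; ComputesWithin)

-- Runs of the machine and shapes of its tapes

infix  4 _⟶[_]_
infixr 5 _▹_

data _⟶[_]_ : Config → ℕ → Config → Set where
  rest : ∀ {c} → c ⟶[ 0 ] c
  _▹_  : ∀ {c d e k} → step c ≡ just d → d ⟶[ k ] e → c ⟶[ suc k ] e

⟶-trans : ∀ {c d e k l} → c ⟶[ k ] d → d ⟶[ l ] e → c ⟶[ k + l ] e
⟶-trans rest     ss = ss
⟶-trans (s ▹ rs) ss = s ▹ ⟶-trans rs ss

⟶-halts : ∀ {c d e k l} → c ⟶[ k ] d → HaltsAfter d l e → HaltsAfter c (k + l) e
⟶-halts rest     h = h
⟶-halts (s ▹ rs) h = next s (⟶-halts rs h)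

-- The heads stand on the first cell of the right part and on the first cell of
-- the left part, respectively.
onRight onLeft : List Cell → List Cell → Tape
onRight ls []       = tape ls nothing []
onRight ls (c ∷ rs) = tape ls c rs
onLeft []       rs = tape [] nothing rs
onLeft (c ∷ ls) rs = tape ls c rs

act-right : ∀ c ls d rs → act (c , right) (tape ls d rs) ≡ onRight (c ∷ ls) rs
act-right c ls d []      = refl
act-right c ls d (_ ∷ _) = refl

act-left : ∀ c ls d rs → act (c , left) (tape ls d rs) ≡ onLeft ls (c ∷ rs)
act-left c []      d rs = refl
act-left c (_ ∷ _) d rs = refl

outputWord-onRight : ∀ ls rs → outputWord (onRight ls rs) ≡ blankFreePrefix rs
outputWord-onRight ls []      = refl
outputWord-onRight ls (_ ∷ _) = refl

marks : ℕ → List Cell → List Cell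
marks k cs = replicate k mark ++ cs

marks-mark : ∀ k cs → marks k (mark ∷ cs) ≡ marks (suc k) cs
marks-mark zero    cs = refl
marks-mark (suc k) cs = cong (mark ∷_) (marks-mark k cs)

-- The blank beneath the marks is the cell that the work head leaves in the first step; leftward
-- sweeps stop on it.
counter : ℕ → Tape
counter k = tape (marks k [ nothing ]) nothing []

-- Reading the input

WorkTapes : Set
WorkTapes = Vec Tape 3

scanning : List Symbol → List Symbol → Tape
scanning done todo = onRight (map just done) (map just todo)

-- Quantifying over what precedes and follows `w` makes the run local, so that runs over adjacent
-- words compose. Each symbol costs one step, whence the time `length w`.
record Scans (q : State) (ts : WorkTapes) (w : List Symbol) (q′ : State) (ts′ : WorkTapes) : Set where
  constructor scans
  field
    run : ∀ done todo →
      (q , scanning done (w ++ todo) ∷ ts) ⟶[ length w ] (q′ , scanning (w ʳ++ done) todo ∷ ts′)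

open Scans

infixr 6 _⨾_

_⨾_ : ∀ {q q′ q″ ts ts′ ts″ v w} →
  Scans q ts v q′ ts′ → Scans q′ ts′ w q″ ts″ → Scans q ts (v ++ w) q″ ts″
run (_⨾_ {v = v} {w} r s) done todo
  rewrite ++-assoc v w todo | length-++ v {w} | ++-ʳ++ v {w} {done} =
  ⟶-trans (run r done (w ++ todo)) (run s (v ʳ++ done) todo)

scan-ε : ∀ {q ts} → Scans q ts [] q ts
scan-ε = scans λ _ _ → rest

scan₁ : ∀ {q q′ ts ts′ x} →
  (∀ done todo → step (q , scanning done (x ∷ todo) ∷ ts)
     ≡ just (q′ , act (just x , right) (scanning done (x ∷ todo)) ∷ ts′)) →
  Scans q ts [ x ] q′ ts′
scan₁ {ts′ = ts′} {x} eq = scans λ done todo →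
  trans (eq done todo) (cong (λ t → just (_ , t ∷ ts′)) (act-right (just x) (map just done) _ (map just todo)))
    ▹ rest

scan-row : ∀ {A : Set} {ts} (h : A → Bool) vs → Scans inRow ts (map (bit ∘ h) vs) inRow ts
scan-row h [] = scan-ε
-- With the three work tapes exposed and the bit known, `step` computes and the transition holds by
-- `refl`.
scan-row {ts = _ ∷ _ ∷ _ ∷ []} h (v ∷ vs) with h v
... | true  = scan₁ (λ _ _ → refl) ⨾ scan-row h vs
... | false = scan₁ (λ _ _ → refl) ⨾ scan-row h vs

-- Rows must be nonempty here: in `rowStart` a ♯ means the end of the matrix, so an empty row would
-- be mistaken for it. A graph of order 0 has no rows at all, and `scan-matrix` treats it apart.
scan-rows : ∀ {A B : Set} {ts} (h : A → B → Bool) us v vs →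
  Scans rowStart ts (concatMap (λ u → map (bit ∘ h u) (v ∷ vs) ++ [ ♯ ]) us) rowStart ts
scan-rows h [] v vs = scan-ε
scan-rows {ts = ts@(_ ∷ _ ∷ _ ∷ [])} h (u ∷ us) v vs =
  (first (h u v) ⨾ scan-row (h u) vs ⨾ scan₁ (λ _ _ → refl)) ⨾ scan-rows h us v vs
  where
  first : ∀ x → Scans rowStart ts [ bit x ] inRow ts
  first true  = scan₁ (λ _ _ → refl)
  first false = scan₁ (λ _ _ → refl)

scan-ones : ∀ {ts} k → Scans inNames ts (replicate k 𝟏) inNames ts
scan-ones zero = scan-ε
scan-ones {_ ∷ _ ∷ _ ∷ []} (suc k) = scan₁ (λ _ _ → refl) ⨾ scan-ones k

-- Only the 𝟎 that closes a name leaves marks, one on tape 1 and one on tape 2; the unary index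
-- before it is skipped. The marks thus count names, whatever vertices carry them.
scan-names : ∀ {A : Set} {C} (h : A → ℕ) is j k →
  Scans inNames (counter j ∷ counter k ∷ C ∷ [])
    (concatMap (λ i → replicate (h i) 𝟏 ++ [ 𝟎 ]) is)
    inNames (counter (length is + j) ∷ counter (length is + k) ∷ C ∷ [])
scan-names h [] j k = scan-ε
scan-names {C = C} h (i ∷ is) j k =
  (scan-ones (h i) ⨾ scan₁ (λ _ _ → refl)) ⨾
  subst₂ (λ j′ k′ → Scans inNames (counter (suc j) ∷ counter (suc k) ∷ C ∷ [])
            (concatMap (λ i → replicate (h i) 𝟏 ++ [ 𝟎 ]) is)
            inNames (counter j′ ∷ counter k′ ∷ C ∷ []))
    (+-suc (length is) j) (+-suc (length is) k)
    (scan-names h is (suc j) (suc k))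

scan-cover : ∀ {n A} (S : Subset n) j k →
  Scans inCover (A ∷ counter j ∷ counter k ∷ []) (encodeSubset S)
    inCover (A ∷ counter (∣ S ∣ + j) ∷ counter (∣ ∁ S ∣ + k) ∷ [])
scan-cover [] j k = scan-ε
scan-cover {A = A} (inside ∷ S) j k = scan₁ (λ _ _ → refl) ⨾
  subst (λ j′ → Scans inCover (A ∷ counter (suc j) ∷ counter k ∷ []) (encodeSubset S)
            inCover (A ∷ counter j′ ∷ counter (∣ ∁ S ∣ + k) ∷ []))
    (+-suc ∣ S ∣ j) (scan-cover S (suc j) k)
scan-cover {A = A} (outside ∷ S) j k = scan₁ (λ _ _ → refl) ⨾
  subst (λ k′ → Scans inCover (A ∷ counter j ∷ counter (suc k) ∷ []) (encodeSubset S)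
            inCover (A ∷ counter (∣ S ∣ + j) ∷ counter k′ ∷ []))
    (+-suc ∣ ∁ S ∣ k) (scan-cover S j (suc k))

-- Both heads move left in step, and `δ` tests tape 3 for the blank before tape 2, so a tie counts
-- as fitting.
compare-≤ : ∀ {j k} → k ≤ j → ∀ {X A} ls rs → ∃[ ts ]
  (compare , X ∷ A ∷ onLeft (marks j [ nothing ]) ls ∷ onLeft (marks k [ nothing ]) rs ∷ [])
    ⟶[ suc k ] (rewind , act (head X , left) X ∷ ts)
compare-≤ z≤n ls rs = _ , refl ▹ rest
compare-≤ {suc j} {suc k} (s≤s k≤j) {X} {A} ls rs with compare-≤ k≤j {X} {A} (mark ∷ ls) (mark ∷ rs)
... | ts , run = ts ,
  cong₂ (λ s t → just (compare , X ∷ A ∷ s ∷ t ∷ []))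
    (act-left mark (marks j [ nothing ]) mark ls) (act-left mark (marks k [ nothing ]) mark rs) ▹ run

-- The final position prepares the writing. Tape 2 stands at its left end as a ruler of `j` cells.
-- Tape 3 has exactly `j` marks from its head on, which will count the rows; the surplus `suc d`
-- stays behind the head. On tape 0 the move to the right leaves a blank between the old input and
-- the output.
compare-> : ∀ {X A} j d ls rs →
  (compare , X ∷ A ∷ onLeft (marks j [ nothing ]) ls ∷ onLeft (marks (suc j + d) [ nothing ]) rs ∷ [])
    ⟶[ suc j ]
  (writeRows , act (head X , right) X ∷ A ∷ tape [] nothing (marks j ls)
                 ∷ onRight (marks (suc d) [ nothing ]) (marks j rs) ∷ [])
compare-> {X} {A} zero d ls rs =
  cong (λ t → just (writeRows , _ ∷ A ∷ tape [] nothing ls ∷ t ∷ [])) (act-right mark (marks d [ nothing ]) mark rs)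
    ▹ rest
compare-> {X} {A} (suc j) d ls rs =
  cong₂ (λ s t → just (compare , X ∷ A ∷ s ∷ t ∷ []))
    (act-left mark (marks j [ nothing ]) mark ls) (act-left mark (marks (suc j + d) [ nothing ]) mark rs)
    ▹ subst₂ (λ ls′ rs′ → (compare , X ∷ A ∷ onLeft (marks j [ nothing ]) (mark ∷ ls)
                              ∷ onLeft (marks (suc j + d) [ nothing ]) (mark ∷ rs) ∷ [])
         ⟶[ suc j ] (writeRows , act (head X , right) X ∷ A ∷ tape [] nothing ls′
                              ∷ onRight (marks (suc d) [ nothing ]) rs′ ∷ []))
       (marks-mark j ls) (marks-mark j rs) (compare-> j d (mark ∷ ls) (mark ∷ rs))

-- Writing the edgeless graph

writing : List Symbol → List Cell → Tape
writing out base = tape (map just out ++ nothing ∷ base) nothing []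

-- The time `k` is separate from the word because turning points and return sweeps take steps
-- without writing a symbol.
record Writes (k : ℕ) (q : State) (ts : WorkTapes) (w : List Symbol) (q′ : State) (ts′ : WorkTapes) : Set where
  constructor writes
  field
    run : ∀ out base →
      (q , writing out base ∷ ts) ⟶[ k ] (q′ , writing (w ʳ++ out) base ∷ ts′)

open Writes renaming (run to runʷ)

infixr 6 _⨟_

_⨟_ : ∀ {k l q q′ q″ ts ts′ ts″ v w} →
  Writes k q ts v q′ ts′ → Writes l q′ ts′ w q″ ts″ → Writes (k + l) q ts (v ++ w) q″ ts″
runʷ (_⨟_ {v = v} {w} r s) out base rewrite ++-ʳ++ v {w} {out} =
  ⟶-trans (runʷ r out base) (runʷ s (v ʳ++ out) base)

write-ε : ∀ {q ts} → Writes 0 q ts [] q ts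
write-ε = writes λ _ _ → rest

write₀ : ∀ {q q′ ts ts′} →
  (∀ out base → step (q , writing out base ∷ ts) ≡ just (q′ , writing out base ∷ ts′)) →
  Writes 1 q ts [] q′ ts′
write₀ eq = writes λ out base → eq out base ▹ rest

write₁ : ∀ {q q′ ts ts′ x} →
  (∀ out base → step (q , writing out base ∷ ts) ≡ just (q′ , writing (x ∷ out) base ∷ ts′)) →
  Writes 1 q ts [ x ] q′ ts′
write₁ eq = writes λ out base → eq out base ▹ rest

write-zeros : ∀ {A C} k ls rs →
  Writes k writeRow (A ∷ onRight ls (marks k rs) ∷ C ∷ []) (replicate k 𝟎)
    writeRow (A ∷ onRight (marks k ls) rs ∷ C ∷ [])
write-zeros zero ls rs = write-ε
write-zeros {A} {C} (suc k) ls rs =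
  write₁ (λ out base → cong (λ t → just (writeRow , writing (𝟎 ∷ out) base ∷ A ∷ t ∷ C ∷ []))
                         (act-right mark ls mark (marks k rs)))
  ⨟ subst (λ ls′ → Writes k writeRow (A ∷ onRight (mark ∷ ls) (marks k rs) ∷ C ∷ []) (replicate k 𝟎)
                     writeRow (A ∷ onRight ls′ rs ∷ C ∷ []))
      (marks-mark k ls) (write-zeros k (mark ∷ ls) rs)

return-row : ∀ {A C} k ls rs →
  Writes k returnRow (A ∷ onLeft (marks k ls) rs ∷ C ∷ []) [] returnRow (A ∷ onLeft ls (marks k rs) ∷ C ∷ [])
return-row zero ls rs = write-ε
return-row {A} {C} (suc k) ls rs =
  write₀ (λ out base → cong (λ t → just (returnRow , writing out base ∷ A ∷ t ∷ C ∷ []))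
                         (act-left mark (marks k ls) mark rs))
  ⨟ subst (λ rs′ → Writes k returnRow (A ∷ onLeft (marks k ls) (mark ∷ rs) ∷ C ∷ []) []
                     returnRow (A ∷ onLeft ls rs′ ∷ C ∷ []))
      (marks-mark k rs) (return-row k ls (mark ∷ rs))

-- The summands follow the phases of `write-row` in their order, so that the composed run has this
-- time definitionally.
rowTime : ℕ → ℕ
rowTime m = suc (m + suc (m + 1))

-- Tape 2 is the ruler: a sweep to the right writes one 𝟎 per mark, the blank at its end triggers
-- the ♯, and a sweep back restores the head. Then tape 3 advances by one mark, the row just
-- written.
write-row : ∀ {A} m ls rs →
  Writes (rowTime m)
    writeRows (A ∷ tape [] nothing (marks m [ nothing ]) ∷ tape ls mark rs ∷ [])
    (replicate m 𝟎 ++ [ ♯ ])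
    writeRows (A ∷ tape [] nothing (marks m [ nothing ]) ∷ onRight (mark ∷ ls) rs ∷ [])
write-row {A} m ls rs =
  write₀ (λ out base → cong (λ t → just (writeRow , writing out base ∷ A ∷ t ∷ C ∷ []))
                         (act-right nothing [] nothing (marks m [ nothing ])))
  ⨟ write-zeros m [ nothing ] [ nothing ]
  ⨟ write₁ (λ out base → cong (λ t → just (returnRow , writing (♯ ∷ out) base ∷ A ∷ t ∷ C ∷ []))
                           (act-left nothing (marks m [ nothing ]) nothing []))
  ⨟ return-row m [ nothing ] [ nothing ]
  ⨟ write₀ (λ out base → cong (λ t → just (writeRows , writing out base ∷ A ∷ tape [] nothing (marks m [ nothing ]) ∷ t ∷ []))
                           (act-right mark ls mark rs))
  where
  C = tape ls mark rs

write-rows : ∀ {A} {U : Set} m (us : List U) ls →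
  Writes (length us * rowTime m)
    writeRows (A ∷ tape [] nothing (marks m [ nothing ]) ∷ onRight ls (marks (length us) [ nothing ]) ∷ [])
    (concatMap (λ _ → replicate m 𝟎 ++ [ ♯ ]) us)
    writeRows (A ∷ tape [] nothing (marks m [ nothing ]) ∷ tape (marks (length us) ls) nothing [] ∷ [])
write-rows m [] ls = write-ε
write-rows {A} m (u ∷ us) ls =
  write-row m ls (marks (length us) [ nothing ])
  ⨟ subst (λ ls′ → Writes (length us * rowTime m)
                     writeRows (A ∷ tape [] nothing (marks m [ nothing ]) ∷ onRight (mark ∷ ls) (marks (length us) [ nothing ]) ∷ [])
                     (concatMap (λ _ → replicate m 𝟎 ++ [ ♯ ]) us)
                     writeRows (A ∷ tape [] nothing (marks m [ nothing ]) ∷ tape ls′ nothing [] ∷ []))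
      (marks-mark (length us) ls) (write-rows m us (mark ∷ ls))

unaryBelow : ℕ → List Symbol
unaryBelow zero    = []
unaryBelow (suc k) = (replicate k 𝟏 ++ [ 𝟎 ]) ++ unaryBelow k

write-ones : ∀ {B C} k ls rs →
  Writes k writeName (onLeft (marks k ls) rs ∷ B ∷ C ∷ []) (replicate k 𝟏)
    writeName (onLeft ls (marks k rs) ∷ B ∷ C ∷ [])
write-ones zero ls rs = write-ε
write-ones {B} {C} (suc k) ls rs =
  write₁ (λ out base → cong (λ t → just (writeName , writing (𝟏 ∷ out) base ∷ t ∷ B ∷ C ∷ []))
                         (act-left mark (marks k ls) mark rs))
  ⨟ subst (λ rs′ → Writes k writeName (onLeft (marks k ls) (mark ∷ rs) ∷ B ∷ C ∷ []) (replicate k 𝟏)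
                     writeName (onLeft ls rs′ ∷ B ∷ C ∷ []))
      (marks-mark k rs) (write-ones k ls (mark ∷ rs))

return-name : ∀ {B C} k ls rs →
  Writes k returnName (onRight ls (marks k rs) ∷ B ∷ C ∷ []) [] returnName (onRight (marks k ls) rs ∷ B ∷ C ∷ [])
return-name zero ls rs = write-ε
return-name {B} {C} (suc k) ls rs =
  write₀ (λ out base → cong (λ t → just (returnName , writing out base ∷ t ∷ B ∷ C ∷ []))
                         (act-right mark ls mark (marks k rs)))
  ⨟ subst (λ ls′ → Writes k returnName (onRight (mark ∷ ls) (marks k rs) ∷ B ∷ C ∷ []) []
                     returnName (onRight ls′ rs ∷ B ∷ C ∷ []))
      (marks-mark k ls) (return-name k (mark ∷ ls) rs)

namesTime : ℕ → ℕ
namesTime zero    = 0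
namesTime (suc k) = suc (k + suc (k + 1)) + namesTime k

-- One of the `suc k` marks is erased first, so the sweep over the remaining ones writes `k` in
-- unary. The blank in place of the erased mark stops the return sweep, which ends ready for the
-- next smaller name.
write-name : ∀ {B C} k rs →
  Writes (suc (k + suc (k + 1)))
    writeNames (onLeft (marks (suc k) [ nothing ]) rs ∷ B ∷ C ∷ [])
    (replicate k 𝟏 ++ [ 𝟎 ])
    writeNames (onLeft (marks k [ nothing ]) (nothing ∷ rs) ∷ B ∷ C ∷ [])
write-name {B} {C} k rs =
  write₀ (λ out base → cong (λ t → just (writeName , writing out base ∷ t ∷ B ∷ C ∷ []))
                         (act-left nothing (marks k [ nothing ]) mark rs))
  ⨟ write-ones k [ nothing ] (nothing ∷ rs)
  ⨟ write₁ (λ out base → cong (λ t → just (returnName , writing (𝟎 ∷ out) base ∷ t ∷ B ∷ C ∷ []))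
                           (act-right nothing [] nothing (marks k (nothing ∷ rs))))
  ⨟ return-name k [ nothing ] (nothing ∷ rs)
  ⨟ write₀ (λ out base → cong (λ t → just (writeNames , writing out base ∷ t ∷ B ∷ C ∷ []))
                           (act-left nothing (marks k [ nothing ]) nothing rs))

write-names : ∀ {B C} k rs → ∃[ rs′ ]
  Writes (namesTime k) writeNames (onLeft (marks k [ nothing ]) rs ∷ B ∷ C ∷ []) (unaryBelow k)
    writeNames (tape [] nothing rs′ ∷ B ∷ C ∷ [])
write-names zero    rs = rs , write-ε
write-names (suc k) rs with write-names k (nothing ∷ rs)
... | rs′ , ws = rs′ , (write-name k rs ⨟ ws)

write-cover : ∀ {A C} k ls rs →
  Writes k writeCover (A ∷ onRight ls (marks k rs) ∷ C ∷ []) (replicate k 𝟎)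
    writeCover (A ∷ onRight (marks k ls) rs ∷ C ∷ [])
write-cover zero ls rs = write-ε
write-cover {A} {C} (suc k) ls rs =
  write₁ (λ out base → cong (λ t → just (writeCover , writing (𝟎 ∷ out) base ∷ A ∷ t ∷ C ∷ []))
                         (act-right mark ls mark (marks k rs)))
  ⨟ subst (λ ls′ → Writes k writeCover (A ∷ onRight (mark ∷ ls) (marks k rs) ∷ C ∷ []) (replicate k 𝟎)
                     writeCover (A ∷ onRight ls′ rs ∷ C ∷ []))
      (marks-mark k ls) (write-cover k (mark ∷ ls) rs)

-- The cells to the left of the word end in a blank, either a written one or the
-- end of the listed part of the tape.
rewind-halts : ∀ {base} → (∀ rs → ∃[ ls ] onLeft base rs ≡ tape ls nothing rs) →
  ∀ {ts} ys rs → ∃[ d ]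
    HaltsAfter (rewind , onLeft (map just ys ++ base) rs ∷ ts) (length ys + 1) d
      × output d ≡ ys ʳ++ blankFreePrefix rs
rewind-halts blank {ts@(A ∷ B ∷ C ∷ [])} [] rs with ls , eq ← blank rs =
  _ , next (trans (cong (λ t → step (rewind , t ∷ ts)) eq)
              (cong (λ t → just (stop , t ∷ ts)) (act-right nothing ls nothing rs)))
           (halted refl)
    , outputWord-onRight (nothing ∷ ls) rs
rewind-halts {base} blank {ts@(A ∷ B ∷ C ∷ [])} (y ∷ ys) rs
  with d , halts , eq ← rewind-halts blank {ts} ys (just y ∷ rs) =
  d , next (cong (λ t → just (rewind , t ∷ ts)) (act-left (just y) (map just ys ++ base) (just y) rs)) halts , eq

-- Runs on a whole instance

scan-matrix : ∀ {n ts} (h : Fin n → Fin n → Bool) →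
  Scans rowStart ts (concatMap (λ u → map (bit ∘ h u) (allFin n) ++ [ ♯ ]) (allFin n)) rowStart ts
scan-matrix {zero}  h = scan-ε
scan-matrix {suc n} h = scan-rows h (allFin (suc n)) zero (tabulate suc)

-- The form records how tape 2 fills up, read from the inside out: 1 for the ♯ after the matrix, `b`
-- for the names, `suc` for the ♯ after the names, |S| for the cover.
capacity : ∀ {n} → ℕ → Subset n → ℕ
capacity b S = ∣ S ∣ + suc (b + 1)

scan-instance : ∀ {b} (G : BoundariedGraph b) (S : Subset (order G)) →
  Scans rowStart (counter 0 ∷ counter 0 ∷ counter 0 ∷ []) (encodeInstance G S)
    inCover (counter b ∷ counter (capacity b S) ∷ counter ∣ ∁ S ∣ ∷ [])
scan-instance {b} G S =
  subst₂ (λ j k → Scans rowStart (counter 0 ∷ counter 0 ∷ counter 0 ∷ []) (encodeInstance G S)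
                    inCover (counter j ∷ counter (capacity k S) ∷ counter ∣ ∁ S ∣ ∷ []))
    (trans (+-identityʳ _) (length-allFin b)) (length-allFin b)
    (subst (λ z → Scans rowStart (counter 0 ∷ counter 0 ∷ counter 0 ∷ []) (encodeInstance G S)
                    inCover (counter (length (allFin b) + 0) ∷ counter (capacity (length (allFin b)) S) ∷ counter z ∷ []))
      (+-identityʳ _)
      ((scan-matrix (λ u v → does (E? G u v))
        ⨾ scan₁ (λ _ _ → refl)
        ⨾ scan-names (toℕ ∘ boundary G) (allFin b) 0 1
        ⨾ scan₁ (λ _ _ → refl))
        ⨾ scan-cover S _ 0))

read-instance : ∀ {b} (G : BoundariedGraph b) (S : Subset (order G)) →
  initial (encodeInstance G S) ⟶[ suc (length (encodeInstance G S) + 1) ]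
    (compare , tape (map just (encodeInstance G S ʳ++ [])) nothing [] ∷ counter b
             ∷ onLeft (marks (capacity b S) [ nothing ]) [ nothing ]
             ∷ onLeft (marks ∣ ∁ S ∣ [ nothing ]) [ nothing ] ∷ [])
read-instance {b} G S =
  begins w ▹
  ⟶-trans
    (subst (λ v → (rowStart , scanning [] v ∷ counter 0 ∷ counter 0 ∷ counter 0 ∷ []) ⟶[ length w ] scanned)
      (++-identityʳ w) (run (scan-instance G S) [] []))
    (cong₂ (λ s t → just (compare , scanning (w ʳ++ []) [] ∷ counter b ∷ s ∷ t ∷ []))
       (act-left nothing (marks (capacity b S) [ nothing ]) nothing [])
       (act-left nothing (marks ∣ ∁ S ∣ [ nothing ]) nothing [])
     ▹ rest)
  where
  w = encodeInstance G S
  scanned : Config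
  scanned = inCover , scanning (w ʳ++ []) [] ∷ counter b ∷ counter (capacity b S) ∷ counter ∣ ∁ S ∣ ∷ []
  begins : ∀ v → step (initial v) ≡ just (rowStart , scanning [] v ∷ counter 0 ∷ counter 0 ∷ counter 0 ∷ [])
  begins []      = refl
  begins (_ ∷ _) = refl

-- The boundary is listed in descending order, so that the machine can write it
-- down while it erases the marks of tape 1 one by one.
edgeless : ∀ {b m} → b ≤ m → BoundariedGraph b
edgeless {b} {m} b≤m = record
  { order              = m
  ; graph              = record { E = λ _ _ → ⊥ ; E-sym = λ () ; E-irrefl = λ () }
  ; E?                 = λ _ _ → no λ ()
  ; boundary           = λ i → inject≤ (opposite i) b≤m
  ; boundary-injective = λ eq → opposite-injective (inject≤-injective b≤m b≤m _ _ eq)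
  }
  where
  opposite-injective : ∀ {i j : Fin b} → opposite i ≡ opposite j → i ≡ j
  opposite-injective {i} {j} eq =
    trans (sym (opposite-involutive i)) (trans (cong opposite eq) (opposite-involutive j))

map-constant : ∀ {A B : Set} (y : B) (xs : List A) → map (λ _ → y) xs ≡ replicate (length xs) y
map-constant y []       = refl
map-constant y (_ ∷ xs) = cong (y ∷_) (map-constant y xs)

concatMap-opposite : ∀ b →
  concatMap (λ i → replicate (toℕ (opposite i)) 𝟏 ++ [ 𝟎 ]) (allFin b) ≡ unaryBelow b
concatMap-opposite b = trans (cong concat (map-tabulate {n = b} id name)) (concat-opposite b)
  where
  name : ∀ {b} → Fin b → List Symbol
  name i = replicate (toℕ (opposite i)) 𝟏 ++ [ 𝟎 ]
  concat-opposite : ∀ b → concat (tabulate {n = b} name) ≡ unaryBelow b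
  concat-opposite zero    = refl
  -- The first name is the largest, `b`; the others are those for one name fewer, as `inject₁` does
  -- not change `toℕ`.
  concat-opposite (suc b) = cong₂ (λ k w → (replicate k 𝟏 ++ [ 𝟎 ]) ++ w) (toℕ-fromℕ b)
    (trans (cong concat (tabulate-cong {n = b} λ i → cong (λ k → replicate k 𝟏 ++ [ 𝟎 ]) (toℕ-inject₁ (opposite i))))
           (concat-opposite b))

blankRows : ℕ → List Symbol
blankRows m = concatMap (λ _ → replicate m 𝟎 ++ [ ♯ ]) (allFin m)

encode-edgeless : ∀ {b m} (b≤m : b ≤ m) →
  encodeInstance (edgeless b≤m) Subset.⊥ ≡ (blankRows m ++ [ ♯ ] ++ unaryBelow b ++ [ ♯ ]) ++ replicate m 𝟎
encode-edgeless {b} {m} b≤m =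
  cong₂ _++_
    (cong₂ (λ row names → concatMap (λ _ → row ++ [ ♯ ]) (allFin m) ++ [ ♯ ] ++ names ++ [ ♯ ])
      (trans (map-constant 𝟎 (allFin m)) (cong (λ k → replicate k 𝟎) (length-allFin m)))
      (trans (concatMap-cong (λ i → cong (λ k → replicate k 𝟏 ++ [ 𝟎 ]) (toℕ-inject≤ (opposite i) b≤m)) (allFin b))
             (concatMap-opposite b)))
    (trans (cong (map bit) (toList-replicate m outside)) (map-replicate bit m outside))

writeTime : ℕ → ℕ → ℕ
writeTime b m = (m * rowTime m + suc (namesTime b + 1)) + m

-- The blocks of the encoding are driven by different tapes: the rows by tapes 2 and 3, the names by
-- tape 1, and the empty cover by tape 2 once more, whose `m` marks survive the rows.
write-edgeless : ∀ {b m} (b≤m : b ≤ m) ls → ∃[ ls′ ] ∃[ A ] ∃[ C ]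
  Writes (writeTime b m)
    writeRows (counter b ∷ tape [] nothing (marks m [ nothing ]) ∷ onRight ls (marks m [ nothing ]) ∷ [])
    (encodeInstance (edgeless b≤m) Subset.⊥)
    writeCover (A ∷ tape ls′ nothing [] ∷ C ∷ [])
write-edgeless {b} {m} b≤m ls with rs , names ← write-names b [ nothing ] =
  marks m [ nothing ] , tape [] nothing rs , tape (marks m ls) nothing [] ,
  subst (λ w → Writes (writeTime b m) writeRows (counter b ∷ B ∷ onRight ls (marks m [ nothing ]) ∷ []) w
                 writeCover (tape [] nothing rs ∷ tape (marks m [ nothing ]) nothing [] ∷ C ∷ [])) (sym (encode-edgeless b≤m))
    ((subst (λ k → Writes (k * rowTime m)
        writeRows (counter b ∷ B ∷ onRight ls (marks k [ nothing ]) ∷ [])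
        (blankRows m)
        writeRows (counter b ∷ B ∷ tape (marks k ls) nothing [] ∷ []))
       (length-allFin m) (write-rows m (allFin m) ls)
     ⨟ write₁ (λ out base → cong (λ t → just (writeNames , writing (♯ ∷ out) base ∷ t ∷ B ∷ C ∷ []))
                              (act-left nothing (marks b [ nothing ]) nothing []))
     ⨟ names
     ⨟ write₁ (λ out base → cong (λ t → just (writeCover , writing (♯ ∷ out) base ∷ tape [] nothing rs ∷ t ∷ C ∷ []))
                              (act-right nothing [] nothing (marks m [ nothing ]))))
     ⨟ write-cover m [ nothing ] [ nothing ])
  where
  B = tape [] nothing (marks m [ nothing ])
  C = tape (marks m ls) nothing []

-- Reading and comparing leave the word on tape 0 intact, so it only remains to bring the head back
-- to its first symbol.
machine-keeps : ∀ {b} (G : BoundariedGraph b) S → ∣ ∁ S ∣ ≤ capacity b S →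
  let w = encodeInstance G S in
  ∃[ d ] HaltsAfter (initial w) (suc (length w + 1) + (suc ∣ ∁ S ∣ + (length w + 1))) d × output d ≡ w
machine-keeps {b} G S fits with compare-≤ fits {tape (map just (encodeInstance G S ʳ++ [])) nothing []} {counter b} [ nothing ] [ nothing ]
... | ts , compared
  with d , halts , eq ← rewind-halts {[]} (λ rs → [] , refl) {ts} (encodeInstance G S ʳ++ []) [ nothing ] =
  d ,
  ⟶-halts (read-instance G S)
    (⟶-halts compared
      (subst₂ (λ t k → HaltsAfter (rewind , t ∷ ts) (k + 1) d)
        (trans (cong (λ ls → onLeft ls [ nothing ]) (++-identityʳ done)) (sym (act-left nothing done nothing [])))
        (trans (length-ʳ++ w) (+-identityʳ _)) halts)) ,
  trans eq (trans (ʳ++-ʳ++ w) (++-identityʳ w))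
  where
  w = encodeInstance G S
  done = map just (w ʳ++ [])

machine-replaces : ∀ {b} (G : BoundariedGraph b) S (b≤m : b ≤ capacity b S) → capacity b S < ∣ ∁ S ∣ →
  let w = encodeInstance G S ; u = encodeInstance (edgeless b≤m) Subset.⊥ ; m = capacity b S in
  ∃[ d ] HaltsAfter (initial w)
           (suc (length w + 1) + (suc m + (writeTime b m + (1 + (length u + 1))))) d
         × output d ≡ u
machine-replaces {b} G S b≤m overflows
  -- `suc k` is the surplus of tape 3 over tape 2.
  with k , eq ← m≤n⇒∃[o]m+o≡n overflows
  with ls′ , A , C , written ← write-edgeless b≤m (marks (suc k) [ nothing ])
  with d , halts , eq′ ← rewind-halts {nothing ∷ map just (encodeInstance G S ʳ++ [])}
         (λ rs → map just (encodeInstance G S ʳ++ []) , refl) {A ∷ tape ls′ nothing [] ∷ C ∷ []}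
         (encodeInstance (edgeless b≤m) Subset.⊥ ʳ++ []) [ nothing ] =
  d ,
  ⟶-halts (read-instance G S)
    (⟶-halts
      (subst (λ z → (compare , X ∷ counter b ∷ onLeft (marks m [ nothing ]) [ nothing ]
                             ∷ onLeft (marks z [ nothing ]) [ nothing ] ∷ []) ⟶[ suc m ]
                    (writeRows , writing [] done ∷ counter b ∷ tape [] nothing (marks m [ nothing ])
                               ∷ onRight (marks (suc k) [ nothing ]) (marks m [ nothing ]) ∷ []))
        eq (compare-> m k [ nothing ] [ nothing ]))
    (⟶-halts (runʷ written [] done)
    (next (cong (λ t → just (rewind , t ∷ ts)) (act-left nothing (map just (u ʳ++ []) ++ nothing ∷ done) nothing []))
      (subst (λ l → HaltsAfter (rewind , onLeft (map just (u ʳ++ []) ++ nothing ∷ done) [ nothing ] ∷ ts) (l + 1) d) (trans (length-ʳ++ u) (+-identityʳ _)) halts)))) ,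
  trans eq′ (trans (ʳ++-ʳ++ u) (++-identityʳ u))
  where
  w = encodeInstance G S
  u = encodeInstance (edgeless b≤m) Subset.⊥
  m = capacity b S
  done = map just (w ʳ++ [])
  X = tape done nothing []
  ts = A ∷ tape ls′ nothing [] ∷ C ∷ []

-- Sizes and running times

length-concatMap-≤ : ∀ {A B : Set} {f : A → List B} {k} → (∀ x → length (f x) ≤ k) →
  ∀ xs → length (concatMap f xs) ≤ length xs * k
length-concatMap-≤ f≤k []                 = z≤n
length-concatMap-≤ {f = f} {k} f≤k (x ∷ xs) = begin
  length (f x ++ concatMap f xs)         ≡⟨ length-++ (f x) ⟩
  length (f x) + length (concatMap f xs) ≤⟨ +-mono-≤ (f≤k x) (length-concatMap-≤ f≤k xs) ⟩
  k + length xs * k                      ∎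
  where open ≤-Reasoning

-- The matrix has `n` rows of `n + 1` symbols. A name takes at most `n` symbols, its index being
-- below `n` and followed by one 𝟎. The two units are the closing ♯ of each block.
graphSize : ℕ → ℕ → ℕ
graphSize b n = n * (n + 1) + suc (b * n + 1)

graphSize-mono-≤ : ∀ {b b′ n n′} → b ≤ b′ → n ≤ n′ → graphSize b n ≤ graphSize b′ n′
graphSize-mono-≤ b≤b′ n≤n′ =
  +-mono-≤ (*-mono-≤ n≤n′ (+-monoˡ-≤ 1 n≤n′)) (s≤s (+-monoˡ-≤ 1 (*-mono-≤ b≤b′ n≤n′)))

length-encodeGraph-≤ : ∀ {b} (G : BoundariedGraph b) → length (encodeGraph G) ≤ graphSize b (order G)
length-encodeGraph-≤ {b} G = begin
  length (rows ++ ♯ ∷ names ++ [ ♯ ])      ≡⟨ length-++ rows ⟩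
  length rows + suc (length (names ++ [ ♯ ])) ≡⟨ cong (λ k → length rows + suc k) (length-++ names) ⟩
  length rows + suc (length names + 1)
    ≤⟨ +-mono-≤ (length-concatMap-≤ row≤ (allFin n)) (s≤s (+-monoˡ-≤ 1 (length-concatMap-≤ name≤ (allFin b)))) ⟩
  length (allFin n) * (n + 1) + suc (length (allFin b) * n + 1)
    ≡⟨ cong₂ (λ j k → j * (n + 1) + suc (k * n + 1)) (length-allFin n) (length-allFin b) ⟩
  graphSize b n                            ∎
  where
  open ≤-Reasoning
  n = order G
  rows = concatMap (λ u → map (λ v → bit (does (E? G u v))) (allFin n) ++ [ ♯ ]) (allFin n)
  names = concatMap (λ i → replicate (toℕ (boundary G i)) 𝟏 ++ [ 𝟎 ]) (allFin b)
  row≤ : ∀ u → length (map (λ v → bit (does (E? G u v))) (allFin n) ++ [ ♯ ]) ≤ n + 1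
  row≤ u = ≤-reflexive (trans (length-++ (map _ (allFin n)))
    (cong (_+ 1) (trans (length-map _ (allFin n)) (length-allFin n))))
  name≤ : ∀ i → length (replicate (toℕ (boundary G i)) 𝟏 ++ [ 𝟎 ]) ≤ n
  name≤ i = begin
    length (replicate (toℕ (boundary G i)) 𝟏 ++ [ 𝟎 ])   ≡⟨ length-++ (replicate (toℕ (boundary G i)) 𝟏) ⟩
    length (replicate (toℕ (boundary G i)) 𝟏) + 1        ≡⟨ cong (_+ 1) (length-replicate _) ⟩
    toℕ (boundary G i) + 1                               ≡⟨ +-comm _ 1 ⟩
    suc (toℕ (boundary G i))                             ≤⟨ toℕ<n (boundary G i) ⟩
    n                                                    ∎

length-encodeSubset : ∀ {n} (S : Subset n) → length (encodeSubset S) ≡ n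
length-encodeSubset S = trans (length-map bit (Vec.toList S)) (length-toList S)

length-encodeInstance-≤ : ∀ {b} (G : BoundariedGraph b) S →
  length (encodeInstance G S) ≤ graphSize b (order G) + order G
length-encodeInstance-≤ G S =
  ≤-trans (≤-reflexive (length-++ (encodeGraph G)))
    (+-mono-≤ (length-encodeGraph-≤ G) (≤-reflexive (length-encodeSubset S)))

order≤length : ∀ {b} (G : BoundariedGraph b) S → order G ≤ length (encodeInstance G S)
order≤length G S = begin
  order G                                           ≡⟨ length-encodeSubset S ⟨
  length (encodeSubset S)                           ≤⟨ m≤n+m _ (length (encodeGraph G)) ⟩
  length (encodeGraph G) + length (encodeSubset S)  ≡⟨ length-++ (encodeGraph G) ⟨
  length (encodeInstance G S)                       ∎
  where open ≤-Reasoning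

rowTime-mono-≤ : ∀ {j k} → j ≤ k → rowTime j ≤ rowTime k
rowTime-mono-≤ j≤k = s≤s (+-mono-≤ j≤k (s≤s (+-monoˡ-≤ 1 j≤k)))

namesTime-≤ : ∀ {j k} → j ≤ k → namesTime j ≤ j * rowTime k
namesTime-≤ {zero}  _   = z≤n
namesTime-≤ {suc j} j<k = +-mono-≤ (rowTime-mono-≤ (<⇒≤ j<k)) (namesTime-≤ (<⇒≤ j<k))

writeTime-≤ : ∀ {b m l} → b ≤ l → m ≤ l → writeTime b m ≤ (l * rowTime l + suc (l * rowTime l + 1)) + l
writeTime-≤ {l = l} b≤l m≤l =
  +-mono-≤ (+-mono-≤ (*-mono-≤ m≤l (rowTime-mono-≤ m≤l))
    (s≤s (+-monoˡ-≤ 1 (≤-trans (namesTime-≤ b≤l) (*-monoˡ-≤ (rowTime l) b≤l))))) m≤l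

-- This is the bound on the replacing run with `b` and the capacity both raised to the input length,
-- expanded without slack; the keeping run fits below it.
timePolynomial : Polynomial
timePolynomial = 9 ∷ 11 ∷ 6 ∷ []

keepTime-≤ : ∀ {z l} → z ≤ l → suc (l + 1) + (suc z + (l + 1)) ≤ ⟦ timePolynomial ⟧ l
keepTime-≤ {z} {l} z≤l = begin
  suc (l + 1) + (suc z + (l + 1))  ≤⟨ +-monoʳ-≤ (suc (l + 1)) (+-monoˡ-≤ (l + 1) (s≤s z≤l)) ⟩
  suc (l + 1) + (suc l + (l + 1))  ≤⟨ m≤m+n _ (5 + (8 * l + 6 * (l * l))) ⟩
  suc (l + 1) + (suc l + (l + 1)) + (5 + (8 * l + 6 * (l * l))) ≡⟨ expand l ⟩
  ⟦ timePolynomial ⟧ l             ∎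
  where
  open ≤-Reasoning
  expand : ∀ l → suc (l + 1) + (suc l + (l + 1)) + (5 + (8 * l + 6 * (l * l)))
                   ≡ 9 + l * (11 + l * (6 + l * 0))
  expand = solve-∀

replaceTime-≤ : ∀ {b m l u} → b ≤ l → m ≤ l → u ≤ graphSize b m + m →
  suc (l + 1) + (suc m + (writeTime b m + (1 + (u + 1)))) ≤ ⟦ timePolynomial ⟧ l
replaceTime-≤ {b} {m} {l} {u} b≤l m≤l u≤ = begin
  suc (l + 1) + (suc m + (writeTime b m + (1 + (u + 1))))
    ≤⟨ +-monoʳ-≤ (suc (l + 1)) (+-mono-≤ (s≤s m≤l) (+-mono-≤ (writeTime-≤ b≤l m≤l)
         (s≤s (+-monoˡ-≤ 1 (≤-trans u≤ (+-mono-≤ (graphSize-mono-≤ b≤l m≤l) m≤l)))))) ⟩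
  suc (l + 1) + (suc l + ((l * rowTime l + suc (l * rowTime l + 1)) + l + (1 + (graphSize l l + l + 1))))
    ≡⟨ expand l ⟩
  ⟦ timePolynomial ⟧ l
    ∎
  where
  open ≤-Reasoning
  expand : ∀ l →
    suc (l + 1) + (suc l + ((l * suc (l + suc (l + 1)) + suc (l * suc (l + suc (l + 1)) + 1)) + l
      + (1 + (l * (l + 1) + suc (l * l + 1) + l + 1)))) ≡ 9 + l * (11 + l * (6 + l * 0))
  expand = solve-∀

-- The expansion of `graphSize x (linearOrder x)`.
sizePolynomial : Polynomial
sizePolynomial = 8 ∷ 12 ∷ 6 ∷ []

linearOrder : ℕ → ℕ
linearOrder x = 2 * x + 2

graphSize≤⟦sizePolynomial⟧ : ∀ {b n x} → b ≤ x → n ≤ linearOrder x → graphSize b n ≤ ⟦ sizePolynomial ⟧ x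
graphSize≤⟦sizePolynomial⟧ {x = x} b≤x n≤ =
  ≤-trans (graphSize-mono-≤ b≤x n≤) (≤-reflexive (expand x))
  where
  expand : ∀ x → (2 * x + 2) * (2 * x + 2 + 1) + suc (x * (2 * x + 2) + 1) ≡ 8 + x * (12 + x * (6 + x * 0))
  expand = solve-∀

linearOrder≤⟦sizePolynomial⟧ : ∀ x → linearOrder x ≤ ⟦ sizePolynomial ⟧ x
linearOrder≤⟦sizePolynomial⟧ x = ≤-trans (m≤m+n _ (6 + (10 * x + 6 * (x * x)))) (≤-reflexive (expand x))
  where
  expand : ∀ x → 2 * x + 2 + (6 + (10 * x + 6 * (x * x))) ≡ 8 + x * (12 + x * (6 + x * 0))
  expand = solve-∀

linearOrder∈O : linearOrder ∈O (λ x → x)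
-- From `n` = 1 on, the additive 2 is at most 2 * `n`, which doubles the coefficient.
linearOrder∈O = 4 , 1 , λ n 1≤n → begin
  2 * n + 2     ≤⟨ +-monoʳ-≤ (2 * n) (*-monoʳ-≤ 2 1≤n) ⟩
  2 * n + 2 * n ≡⟨ expand n ⟩
  4 * n         ∎
  where
  open ≤-Reasoning
  expand : ∀ n → 2 * n + 2 * n ≡ 4 * n
  expand = solve-∀

∣S∣+∣∁S∣≡n : ∀ {n} (S : Subset n) → ∣ S ∣ + ∣ ∁ S ∣ ≡ n
∣S∣+∣∁S∣≡n S = trans (cong (∣ S ∣ +_) (∣∁p∣≡n∸∣p∣ S)) (m+[n∸m]≡n (∣p∣≤n S))

-- The kernel and its properties

module _ {b} (G : BoundariedGraph b) (S : Subset (order G)) where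

  b≤capacity : b ≤ capacity b S
  b≤capacity = ≤-trans (m≤m+n b 1) (≤-trans (n≤1+n _) (m≤n+m _ ∣ S ∣))

  Fits : Set
  Fits = ∣ ∁ S ∣ ≤ capacity b S

  -- With the decision as an argument, each property below is proved by cases on it, and all fields
  -- of the kernelization then share one decision.
  kernelBy : Dec Fits → BoundariedGraph b
  kernelBy (yes _) = G
  kernelBy (no _)  = edgeless b≤capacity

  coverBy : (fits? : Dec Fits) → Subset (order (kernelBy fits?))
  coverBy (yes _) = S
  coverBy (no _)  = Subset.⊥

  kernelBy-computes : (fits? : Dec Fits) → let w = encodeInstance G S in
    ComputesWithin (⟦ timePolynomial ⟧ (length w)) w (encodeInstance (kernelBy fits?) (coverBy fits?))
  kernelBy-computes (yes fits) with d , halts , eq ← machine-keeps G S fits =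
    _ , d , keepTime-≤ (≤-trans (∣p∣≤n (∁ S)) (order≤length G S)) , halts , eq
  kernelBy-computes (no ¬fits) with d , halts , eq ← machine-replaces G S b≤capacity (≰⇒> ¬fits) =
    _ , d , replaceTime-≤ (≤-trans b≤capacity capacity≤) capacity≤ (length-encodeInstance-≤ (edgeless b≤capacity) Subset.⊥) , halts , eq
    where
    -- The overflow itself bounds the capacity: it lies below the number of vertices outside `S`,
    -- hence below the order and the input length.
    capacity≤ : capacity b S ≤ length (encodeInstance G S)
    capacity≤ = ≤-trans (<⇒≤ (≰⇒> ¬fits)) (≤-trans (∣p∣≤n (∁ S)) (order≤length G S))

  kernelBy-cover : IsVertexCover (graph G) S → (fits? : Dec Fits) →
    IsVertexCover (graph (kernelBy fits?)) (coverBy fits?)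
  kernelBy-cover vc (yes _) = vc
  kernelBy-cover vc (no _)  = λ _ _ _ _ ()

  kernelBy-order : (fits? : Dec Fits) → order (kernelBy fits?) ≤ linearOrder (b + ∣ S ∣)
  kernelBy-order (yes fits) = begin
    order G                  ≡⟨ ∣S∣+∣∁S∣≡n S ⟨
    ∣ S ∣ + ∣ ∁ S ∣          ≤⟨ +-monoʳ-≤ ∣ S ∣ fits ⟩
    ∣ S ∣ + capacity b S     ≤⟨ m≤m+n _ b ⟩
    ∣ S ∣ + capacity b S + b ≡⟨ expand b ∣ S ∣ ⟩
    linearOrder (b + ∣ S ∣)  ∎
    where
    open ≤-Reasoning
    expand : ∀ b s → s + (s + suc (b + 1)) + b ≡ 2 * (b + s) + 2
    expand = solve-∀
  kernelBy-order (no _) = ≤-trans (m≤m+n (capacity b S) (b + ∣ S ∣)) (≤-reflexive (expand b ∣ S ∣))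
    where
    expand : ∀ b s → s + suc (b + 1) + (b + s) ≡ 2 * (b + s) + 2
    expand = solve-∀

  kernelBy-equivalent : ∀ Π → (∀ {V} {Γ : Graph V} → Holds Π Γ → Holds HamiltonianPath Γ) →
    IsVertexCover (graph G) S → (fits? : Dec Fits) → GluingEquivalent Π G (kernelBy fits?)
  kernelBy-equivalent Π Π⇒path vc (yes _) H = mk⇔ id id
  kernelBy-equivalent Π Π⇒path vc (no ¬fits) H = mk⇔
    (λ holds → ⊥-elim (¬fits (≤-trans (hamiltonianPath⇒∣∁S∣≤ G H S vc (Π⇒path holds))
      -- The path bound lies one below `capacity b S`.
      (+-monoʳ-≤ ∣ S ∣ (s≤s (m≤m+n b 1))))))
    -- The same bound for the replacement with its empty cover would force `capacity b S` ≤ b + 1;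
    -- here the extra unit in the capacity is decisive.
    (λ holds → ⊥-elim (≤⇒≯ (hamiltonianPath⇒∣∁S∣≤ (edgeless b≤capacity) H Subset.⊥ (λ _ _ _ _ ()) (Π⇒path holds))
      overflows))
    where
    open ≤-Reasoning
    overflows : ∣ Subset.⊥ {capacity b S} ∣ + suc b < ∣ ∁ (Subset.⊥ {capacity b S}) ∣
    overflows = begin-strict
      ∣ Subset.⊥ {capacity b S} ∣ + suc b          ≡⟨ cong (_+ suc b) (∣⊥∣≡0 (capacity b S)) ⟩
      suc b                                        <⟨ s≤s (≤-reflexive (+-comm 1 b)) ⟩
      suc (b + 1)                                  ≤⟨ m≤n+m _ ∣ S ∣ ⟩
      capacity b S                                 ≡⟨ cong (capacity b S ∸_) (∣⊥∣≡0 (capacity b S)) ⟨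
      capacity b S ∸ ∣ Subset.⊥ {capacity b S} ∣   ≡⟨ ∣∁p∣≡n∸∣p∣ (Subset.⊥ {capacity b S}) ⟨
      ∣ ∁ (Subset.⊥ {capacity b S}) ∣              ∎

kernelization : ∀ Π → (∀ {V} {Γ : Graph V} → Holds Π Γ → Holds HamiltonianPath Γ) →
  PolynomialKernelizationOfLinearOrder Π
kernelization Π Π⇒path = sizePolynomial , reduction , linearOrder , linearOrder∈O , λ G S _ → kernelBy-order G S (fits? G S)
  where
  fits? : ∀ {b} (G : BoundariedGraph b) S → Dec (Fits G S)
  fits? {b} G S = ∣ ∁ S ∣ ≤? capacity b S
  reduction : BoundariedKernelization[vc] Π ⟦ sizePolynomial ⟧
  reduction = record
    { machine     = kernelMachine
    ; time        = timePolynomial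
    ; kernel      = λ G S _ → kernelBy G S (fits? G S)
    ; cover       = λ G S _ → coverBy G S (fits? G S)
    ; computes    = λ G S _ → kernelBy-computes G S (fits? G S)
    ; equivalent  = λ G S vc → kernelBy-equivalent G S Π Π⇒path vc (fits? G S)
    ; is-cover    = λ G S vc → kernelBy-cover G S vc (fits? G S)
    ; graph-size  = λ {b} G S _ → ≤-trans (length-encodeGraph-≤ (kernelBy G S (fits? G S)))
        (graphSize≤⟦sizePolynomial⟧ (m≤m+n b ∣ S ∣) (kernelBy-order G S (fits? G S)))
    ; cover-size  = λ G S _ → ≤-trans (≤-reflexive (length-encodeSubset (coverBy G S (fits? G S)))) (order≤size G S)
    ; cover-value = λ G S _ → ≤-trans (∣p∣≤n (coverBy G S (fits? G S))) (order≤size G S)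
    }
    where
    order≤size : ∀ {b} (G : BoundariedGraph b) S → order (kernelBy G S (fits? G S)) ≤ ⟦ sizePolynomial ⟧ (b + ∣ S ∣)
    order≤size {b} G S = ≤-trans (kernelBy-order G S (fits? G S)) (linearOrder≤⟦sizePolynomial⟧ (b + ∣ S ∣))

mainTheorem8 : PolynomialKernelizationOfLinearOrder HamiltonianCycle × PolynomialKernelizationOfLinearOrder HamiltonianPath
mainTheorem8 = kernelization HamiltonianCycle (λ {_} {Γ} → cycle⇒path {G = Γ}) , kernelization HamiltonianPath id
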